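{- For every integer $n \geq 3$ and every proper subset $\mathcal{I}$ of $\{0,1,\ldots,n-1\}$ there exists an $n$-maniplex of type $2_{\mathcal{I}}^n$.
   Context: An $n$-maniplex $\mathcal{M}$ is a pair $(\mathcal{F},\{r_0,\ldots,r_{n-1}\})$ where $\mathcal{F}$ is a non-empty set (whose elements are called flags) and $r_0,\ldots,r_{n-1}$ are fixed-point-free involutory permutations of $\mathcal{F}$ such that: the group $\langle r_0,\ldots,r_{n-1}\rangle$ (the monodromy group) is transitive on $\mathcal{F}$; for every flag $\Phi$ and $i\neq j$, $\Phi^{r_i}\neq\Phi^{r_j}$; and $r_ir_j=r_jr_i$ whenever $|i-j|\geq 2$. Equivalently, it is a connected $n$-regular graph with a proper edge-colouring by colours $0,\ldots,n-1$ in which, for $|i-j|\ge 2$, the edges of colours $i$ and $j$ induce disjoint $4$-cycles. Flags $\Phi$ and $\Phi^{r_i}$ are called $i$-adjacent. An automorphism of $\mathcal{M}$ is a permutation of $\mathcal{F}$ commuting with every $r_i$; they form the group $\mathrm{Aut}(\mathcal{M})$. The symmetry type graph of $\mathcal{M}$ is the edge-coloured pregraph whose vertices are the $\mathrm{Aut}(\mathcal{M})$-orbits on flags, where for each colour $i$ and orbit $O$ (letting $O^{r_i}$ be the orbit containing $\Phi^{r_i}$ for any $\Phi\in O$, which is well defined) $O$ carries an $i$-coloured semi-edge if $O^{r_i}=O$, and otherwise $O$ and $O^{r_i}$ are joined by an $i$-coloured edge. For $\mathcal{I}\subseteq\{0,\ldots,n-1\}$, $2_{\mathcal{I}}^n$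 denotes the coloured pregraph with two vertices $u,v$, having for each $i\in\mathcal{I}$ an $i$-coloured semi-edge at $u$ and one at $v$, and for each $i\notin\mathcal{I}$ an $i$-coloured edge joining $u$ and $v$. A maniplex is of type $2_{\mathcal{I}}^n$ if its symmetry type graph is isomorphic (as a coloured pregraph) to $2_{\mathcal{I}}^n$; in particular it then has exactly two flag-orbits under its automorphism group. -}

module Defs where

open import Data.Nat using (ℕ; _≤_; ∣_-_∣)
open import Data.Fin using (Fin; toℕ)
open import Data.Fin.Subset using (Subset; _∈_; _∉_)
open import Data.Bool using (Bool)
open import Data.List using (List; foldl)
open import Data.Product using (Σ; ∃; _×_)
open import Relation.Binary.PropositionalEquality using (_≡_; _≢_)
open import Function.Bundles using (_⇔_)

record Maniplex (n : ℕ) : Set₁ where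
  field
    Flag      : Set
    r         : Fin n → Flag → Flag
    nonempty  : Flag
    invol     : ∀ i Φ → r i (r i Φ) ≡ Φ
    fixfree   : ∀ i Φ → r i Φ ≢ Φ
    distinct  : ∀ i j Φ → i ≢ j → r i Φ ≢ r j Φ
    commute   : ∀ i j Φ → 2 ≤ ∣ toℕ i - toℕ j ∣ → r i (r j Φ) ≡ r j (r i Φ)

  act : List (Fin n) → Flag → Flag
  act w Φ = foldl (λ Ψ i → r i Ψ) Φ w

  field
    transitive : ∀ Φ Ψ → ∃ λ (w : List (Fin n)) → act w Φ ≡ Ψ

open Maniplex public

record Automorphism {n : ℕ} (M : Maniplex n) : Set where
  field
    to        : Flag M → Flag M
    from      : Flag M → Flag M
    to-from   : ∀ Φ → to (from Φ) ≡ Φ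
    from-to   : ∀ Φ → from (to Φ) ≡ Φ
    preserves : ∀ i Φ → to (r M i Φ) ≡ r M i (to Φ)

open Automorphism public

SameOrbit : {n : ℕ} (M : Maniplex n) → Flag M → Flag M → Set
SameOrbit M Φ Ψ = ∃ λ (α : Automorphism M) → to α Φ ≡ Ψ

-- M is of type 2_I^n: the symmetry type graph is isomorphic to 2_I^n.
-- The isomorphism is given by a labelling c of flags by the two vertices
-- (false = u, true = v) such that the Aut(M)-orbits are exactly the fibres
-- of c, both vertices occur, and for each colour i, r_i keeps the orbit
-- (semi-edge) iff i ∈ I, and switches orbits (edge u—v) iff i ∉ I.
IsOfType2 : {n : ℕ} → Subset n → Maniplex n → Set
IsOfType2 {n} I M =
  Σ (Flag M → Bool) λ c →
      (∀ Φ Ψ → SameOrbit M Φ Ψ ⇔ (c Φ ≡ c Ψ))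
    × (∀ b → ∃ λ Φ → c Φ ≡ b)
    × (∀ (i : Fin n) Φ → (i ∈ I → c (r M i Φ) ≡ c Φ) × (i ∉ I → c (r M i Φ) ≢ c Φ))

{-# OPTIONS --safe #-}
module Submission where

open import Defs
open import Data.Nat using (ℕ; zero; suc; _≤_; _<_; _+_; _*_; _∸_; _≤?_; s≤s; ∣_-_∣)
open import Data.Nat.Properties as ℕ using ()
open import Data.Nat.Induction using (<-wellFounded)
open import Data.Fin using (Fin; zero; suc; toℕ; inject₁; fromℕ)
open import Data.Fin.Induction using (<-weakInduction)
open import Data.Fin.Patterns
open import Data.Fin.Properties as Fin using (pigeonhole; any?; all?)
open import Data.Fin.Relation.Unary.Top using (View; ‵fromℕ; ‵inj₁; view; view-inject₁)
open import Data.Fin.Subset using (Subset; _⊂_; ⊤; _∈_; _∉_)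
open import Data.Bool using (Bool; true; false; not; _xor_; if_then_else_)
open import Data.Bool.Properties as Bool using ()
open import Data.List using (List; []; _∷_; _++_; [_]; foldl; map; length; take; drop; reverse)
open import Data.List.Properties as List using (foldl-++)
open import Data.Maybe using (Maybe; just; nothing; maybe′)
open import Data.Product using (∃; _×_; _,_; proj₁; proj₂; uncurry)
open import Data.Product.Function.NonDependent.Propositional using (_×-↔_)
open import Data.Product.Properties as Product using ()
open import Data.Sum using (_⊎_; inj₁; inj₂)
open import Data.Sum.Function.Propositional using (_⊎-↔_)
open import Data.Sum.Properties as Sum using ()
open import Data.Unit as Unit using (tt) renaming (⊤ to Unit)
open import Data.Vec as Vec using (Vec; []; _∷_; lookup; tabulate; updateAt)
open import Data.Vec.Properties as Vec using (lookup-map; lookup∘tabulate; tabulate∘lookup; tabulate-cong)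
open import Function using (_∘_; id; _↔_; mk↔ₛ′; Inverse; mk⇔)
open import Function.Construct.Composition using (_↔-∘_)
open import Function.Construct.Identity using (↔-id)
open import Function.Properties.Inverse using (↔-sym; Inverse⇒Injection)
open import Induction.WellFounded using (Acc; acc)
open import Relation.Binary.Definitions using (DecidableEquality)
open import Relation.Binary.PropositionalEquality hiding ([_])
open import Relation.Nullary using (Dec; yes; no; does; contradiction; recompute)
open import Relation.Nullary.Decidable using (map′; _⊎-dec_; _→-dec_; _×-dec_; True; toWitness; False; toWitnessFalse)

-- Let W be generated by involutions r₀, …, r_{n-1}, with rᵢ rⱼ = rⱼ rᵢ for |i - j| ≥ 2.  Let W act on
-- finitely many points carrying one of two labels, rᵢ exchanging the labels precisely when i ∉ I, and
-- let H consist of the words that fix every point labelled false.  Words preserving the labels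
-- normalise H, so they act by automorphisms on the cosets H g, and these cosets are the flags.  A word
-- that fixes all points labelled false but moves a point labelled true rules out any automorphism
-- exchanging the labels.  To separate Φ from its neighbours and these from each other, every point
-- also carries a vector in (ℤ/2)ⁿ whose i-th entry is toggled by rᵢ; the square of a word fixes it.
--
-- A letter of I may act trivially at either end of the sequence of colours, so for n ≥ 4 both 0 and
-- n - 1 can be assumed to lie outside I.  Then r_{n-1} is made to act on both labels mutually inversely,
-- by a 3-cycle on A, B, C from label false and by its inverse from label true, while some h acts as a
-- 3-cycle that moves A and is disjoint from its conjugate by r₀, which moves B.  Conjugating h by
-- r_{n-1} replaces A by C or by B, according to the label, so that the result commutes with the
-- conjugate by r₀ on one label only.

-- Words acting on a set, and their inverses

walk : {A B : Set} → (B → A → A) → List B → A → A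
walk f w x = foldl (λ y i → f i y) x w

walk-++ : {A B : Set} (f : B → A → A) (v w : List B) (x : A) →
          walk f (v ++ w) x ≡ walk f w (walk f v x)
walk-++ f v w x = foldl-++ (λ y i → f i y) x v w

module Involutions {A B : Set} (f : B → A → A) (inv : ∀ i x → f i (f i x) ≡ x) where

  walk-reverse : ∀ w x → walk f (reverse w) (walk f w x) ≡ x
  walk-reverse []      x = refl
  walk-reverse (i ∷ w) x = begin
    walk f (reverse (i ∷ w)) y         ≡⟨ cong (λ v → walk f v y) (List.unfold-reverse i w) ⟩
    walk f (reverse w ++ [ i ]) y      ≡⟨ walk-++ f (reverse w) [ i ] y ⟩
    f i (walk f (reverse w) y)         ≡⟨ cong (f i) (walk-reverse w (f i x)) ⟩
    f i (f i x)                        ≡⟨ inv i x ⟩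
    x                                  ∎
    where
    open ≡-Reasoning
    y = walk f w (f i x)

  walk-unreverse : ∀ w x → walk f w (walk f (reverse w) x) ≡ x
  walk-unreverse w x =
    trans (cong (λ v → walk f v (walk f (reverse w) x)) (sym (List.reverse-involutive w))) (walk-reverse (reverse w) x)

-- Finite types and decidable reachability

Finite : Set → Set
Finite A = ∃ λ m → Fin m ↔ A

finite-Bool : Finite Bool
finite-Bool = 2 , Fin.2↔Bool

finite-Unit : Finite Unit
finite-Unit = 1 , Fin.1↔⊤

finite-× : {A B : Set} → Finite A → Finite B → Finite (A × B)
finite-× (m , e) (k , f) = m * k , (e ×-↔ f) ↔-∘ Fin.*↔×

finite-⊎ : {A B : Set} → Finite A → Finite B → Finite (A ⊎ B)
finite-⊎ (m , e) (k , f) = m + k , (e ⊎-↔ f) ↔-∘ Fin.+↔⊎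

vec-uncons : {A : Set} {n : ℕ} → (A × Vec A n) ↔ Vec A (suc n)
vec-uncons = mk↔ₛ′ (uncurry _∷_) (λ { (x ∷ v) → x , v }) (λ { (_ ∷ _) → refl }) (λ { (_ , _) → refl })

finite-Vec : {A : Set} → Finite A → ∀ n → Finite (Vec A n)
finite-Vec fin zero    = 1 , mk↔ₛ′ (λ _ → []) (λ _ → zero) (λ { [] → refl }) (λ { zero → refl })
finite-Vec fin (suc n) = let m , e = finite-× fin (finite-Vec fin n) in m , vec-uncons ↔-∘ e

finite⇒≟ : {A : Set} → Finite A → DecidableEquality A
finite⇒≟ (_ , e) = Fin.inj⇒≟ (Inverse⇒Injection (↔-sym e))

module Reachability {S : Set} (fin : Finite S) {n : ℕ} (a : Fin n → S → S) where

  private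
    size = proj₁ fin
    open Inverse (proj₂ fin) using () renaming (from to index; to to element; strictlyInverseˡ to element-index)

  Reaches : S → S → Set
  Reaches s t = ∃ λ w → walk a w s ≡ t

  -- Stopping early is allowed, so that a search to depth `size` covers all shorter words too, and
  -- the relation is decidable by recursion on the bound.
  WithinSteps : ℕ → S → S → Set
  WithinSteps zero    s t = s ≡ t
  WithinSteps (suc k) s t = s ≡ t ⊎ ∃ λ i → WithinSteps k (a i s) t

  withinSteps? : ∀ k s t → Dec (WithinSteps k s t)
  withinSteps? zero    s t = finite⇒≟ fin s t
  withinSteps? (suc k) s t = finite⇒≟ fin s t ⊎-dec any? (λ i → withinSteps? k (a i s) t)

  within⇒reaches : ∀ k {s t} → WithinSteps k s t → Reaches s t
  within⇒reaches zero    e              = [] , e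
  within⇒reaches (suc k) (inj₁ e)       = [] , e
  within⇒reaches (suc k) (inj₂ (i , p)) = let w , e = within⇒reaches k p in i ∷ w , e

  short⇒within : ∀ k w s → length w ≤ k → WithinSteps k s (walk a w s)
  short⇒within zero    []      s _       = refl
  short⇒within (suc k) []      s _       = inj₁ refl
  short⇒within (suc k) (i ∷ w) s (s≤s l) = inj₂ (i , short⇒within k w (a i s) l)

  -- Two prefixes of a long walk end in the same state, and what lies between them can be cut out.
  shorten : ∀ w s → Acc _<_ (length w) → WithinSteps size s (walk a w s)
  shorten w s (acc rec) with ℕ.≤-<-connex (length w) size
  ... | inj₁ short = short⇒within size w s short
  ... | inj₂ long  with pigeonhole (ℕ.m<n⇒m<1+n long) (λ i → index (walk a (take (toℕ i) w) s))
  ...   | i , j , i<j , same = subst (WithinSteps size s) same-end (shorten cut s (rec cut-shorter))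
    where
    p = toℕ i
    q = toℕ j
    cut = take p w ++ drop q w
    same-prefix : walk a (take p w) s ≡ walk a (take q w) s
    same-prefix = trans (sym (element-index _)) (trans (cong element same) (element-index _))
    same-end : walk a cut s ≡ walk a w s
    same-end = begin
      walk a cut s                                 ≡⟨ walk-++ a (take p w) (drop q w) s ⟩
      walk a (drop q w) (walk a (take p w) s)      ≡⟨ cong (walk a (drop q w)) same-prefix ⟩
      walk a (drop q w) (walk a (take q w) s)      ≡⟨ walk-++ a (take q w) (drop q w) s ⟨
      walk a (take q w ++ drop q w) s              ≡⟨ cong (λ v → walk a v s) (List.take++drop≡id q w) ⟩
      walk a w s                                   ∎
      where open ≡-Reasoning
    q≤length : q ≤ length w
    q≤length = ℕ.≤-pred (Fin.toℕ<n j)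
    cut-shorter : length cut < length w
    cut-shorter = begin-strict
      length cut                                   ≡⟨ List.length-++ (take p w) ⟩
      length (take p w) + length (drop q w)        ≤⟨ ℕ.+-monoˡ-≤ _ (ℕ.≤-trans (ℕ.≤-reflexive (List.length-take p w)) (ℕ.m⊓n≤m p _)) ⟩
      p + length (drop q w)                        <⟨ ℕ.+-monoˡ-< _ i<j ⟩
      q + length (drop q w)                        ≡⟨ cong (q +_) (List.length-drop q w) ⟩
      q + (length w ∸ q)                           ≡⟨ ℕ.m+[n∸m]≡n q≤length ⟩
      length w                                     ∎
      where open ℕ.≤-Reasoning

  reaches? : ∀ s t → Dec (Reaches s t)
  reaches? s t = map′ (within⇒reaches size)
                      (λ { (w , refl) → shorten w s (<-wellFounded (length w)) })
                      (withinSteps? size s t)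

Far : {n : ℕ} → Fin n → Fin n → Set
Far i j = 2 ≤ ∣ toℕ i - toℕ j ∣

-- From actions on labelled points to maniplexes

-- δ i = true means that rᵢ exchanges the labels, that is, i ∉ I.
record Action {n : ℕ} (δ : Fin n → Bool) : Set₁ where
  field
    Point           : Set
    finite          : Finite Point
    move            : Fin n → Bool × Point → Bool × Point
    move-label      : ∀ i l x → proj₁ (move i (l , x)) ≡ δ i xor l
    move-involutive : ∀ i y → move i (move i y) ≡ y
    move-commutes   : ∀ i j y → Far i j → move i (move j y) ≡ move j (move i y)

  step : Fin n → Bool → Point → Point
  step i l x = proj₂ (move i (l , x))

  move-step : ∀ i l x → move i (l , x) ≡ (δ i xor l , step i l x)
  move-step i l x = cong (_, step i l x) (move-label i l x)

module Construction {n : ℕ} {δ : Fin n → Bool} (A : Action δ)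
  (move-free : ∀ i y → Action.move A i y ≢ y)
  (move-distinct : ∀ i j y → i ≢ j → Action.move A i y ≢ Action.move A j y)
  (w : List (Fin n)) (w-fixes : ∀ x → walk (Action.move A) w (false , x) ≡ (false , x))
  (x₀ : Action.Point A) (w-moves : walk (Action.move A) w (true , x₀) ≢ (true , x₀))
  where

  open Action A

  private
    module MoveInv = Involutions move move-involutive

  size = proj₁ finite
  open Inverse (proj₂ finite) using () renaming (from to index; to to point; strictlyInverseˡ to point-index)

  -- The coset H g, stored as the label of (false , x) · g and the images of all points x.
  State : Set
  State = Bool × Vec Point size

  finite-State : Finite State
  finite-State = finite-× finite-Bool (finite-Vec finite size)

  ρ : Fin n → State → State
  ρ i (l , f) = δ i xor l , Vec.map (step i l) f

  start : State
  start = false , tabulate point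

  at : State → Fin size → Bool × Point
  at (l , f) k = l , lookup f k

  at-ρ : ∀ i s k → at (ρ i s) k ≡ move i (at s k)
  at-ρ i (l , f) k =
    trans (cong (δ i xor l ,_) (lookup-map k (step i l) f)) (sym (move-step i l (lookup f k)))

  at-walk : ∀ v s k → at (walk ρ v s) k ≡ walk move v (at s k)
  at-walk []      s k = refl
  at-walk (i ∷ v) s k = trans (at-walk v (ρ i s) k) (cong (walk move v) (at-ρ i s k))

  at-start : ∀ x → at start (index x) ≡ (false , x)
  at-start x = cong (false ,_) (trans (lookup∘tabulate point (index x)) (point-index x))

  k₁ : Fin size
  k₁ = index x₀

  -- The label is stored once per state and is read off at the entry `k₁`, which exists because `x₀`
  -- does.
  at-injective : ∀ {s t} → (∀ k → at s k ≡ at t k) → s ≡ t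
  at-injective {l , f} {m , g} eq = cong₂ _,_ (cong proj₁ (eq k₁)) (begin
    f                   ≡⟨ tabulate∘lookup f ⟨
    tabulate (lookup f) ≡⟨ tabulate-cong (cong proj₂ ∘ eq) ⟩
    tabulate (lookup g) ≡⟨ tabulate∘lookup g ⟩
    g                   ∎)
    where open ≡-Reasoning

  ρ-involutive : ∀ i s → ρ i (ρ i s) ≡ s
  ρ-involutive i s = at-injective λ k →
    trans (at-ρ i (ρ i s) k) (trans (cong (move i) (at-ρ i s k)) (move-involutive i (at s k)))

  module ρInv = Involutions ρ ρ-involutive

  ρ-commutes : ∀ i j s → Far i j → ρ i (ρ j s) ≡ ρ j (ρ i s)
  ρ-commutes i j s far = at-injective λ k → begin
    at (ρ i (ρ j s)) k      ≡⟨ at-ρ i (ρ j s) k ⟩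
    move i (at (ρ j s) k)   ≡⟨ cong (move i) (at-ρ j s k) ⟩
    move i (move j (at s k)) ≡⟨ move-commutes i j (at s k) far ⟩
    move j (move i (at s k)) ≡⟨ cong (move j) (at-ρ i s k) ⟨
    move j (at (ρ i s) k)   ≡⟨ at-ρ j (ρ i s) k ⟨
    at (ρ j (ρ i s)) k      ∎
    where open ≡-Reasoning

  open Reachability finite-State ρ

  record FlagOf : Set where
    constructor flag
    field
      state    : State
      -- Irrelevant, so that equal states give equal flags; a word is recovered by deciding reachability.
      .reached : Reaches start state

  open FlagOf

  flag-≡ : ∀ {Φ Ψ} → state Φ ≡ state Ψ → Φ ≡ Ψ
  flag-≡ refl = refl

  arrive : List (Fin n) → FlagOf
  arrive v = flag (walk ρ v start) (v , refl)

  route : ∀ Φ → Reaches start (state Φ)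
  route (flag s p) = recompute (reaches? start s) p

  word : FlagOf → List (Fin n)
  word Φ = proj₁ (route Φ)

  word-reaches : ∀ Φ → walk ρ (word Φ) start ≡ state Φ
  word-reaches Φ = proj₂ (route Φ)

  adjacent : Fin n → FlagOf → FlagOf
  adjacent i (flag s p) = flag (ρ i s) (extended p)
    where
    extended : Reaches start s → Reaches start (ρ i s)
    extended (v , e) = v ++ [ i ] , trans (walk-++ ρ v [ i ] start) (cong (ρ i) e)

  state-walk : ∀ v Φ → state (walk adjacent v Φ) ≡ walk ρ v (state Φ)
  state-walk []      Φ = refl
  state-walk (i ∷ v) Φ = state-walk v (adjacent i Φ)

  between : ∀ Φ Ψ → ∃ λ v → walk adjacent v Φ ≡ Ψ
  between Φ Ψ = reverse (word Φ) ++ word Ψ , flag-≡ (begin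
    state (walk adjacent (reverse u ++ v) Φ)         ≡⟨ state-walk (reverse u ++ v) Φ ⟩
    walk ρ (reverse u ++ v) (state Φ)                ≡⟨ walk-++ ρ (reverse u) v (state Φ) ⟩
    walk ρ v (walk ρ (reverse u) (state Φ))          ≡⟨ cong (walk ρ v ∘ walk ρ (reverse u)) (word-reaches Φ) ⟨
    walk ρ v (walk ρ (reverse u) (walk ρ u start))   ≡⟨ cong (walk ρ v) (ρInv.walk-reverse u start) ⟩
    walk ρ v start                                   ≡⟨ word-reaches Ψ ⟩
    state Ψ                                          ∎)
    where
    open ≡-Reasoning
    u = word Φ
    v = word Ψ

  maniplex : Maniplex n
  maniplex = record
    { Flag       = FlagOf
    ; r          = adjacent
    ; nonempty   = arrive []
    ; invol      = λ i Φ → flag-≡ (ρ-involutive i (state Φ))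
    -- A single entry suffices, because a letter moves every point; `k₁` is at hand. The same entry
    -- separates different neighbours below.
    ; fixfree    = λ i Φ e → move-free i _ (trans (sym (at-ρ i (state Φ) k₁)) (cong (λ Ψ → at (state Ψ) k₁) e))
    ; distinct   = λ i j Φ i≢j e → move-distinct i j _ i≢j
                     (trans (sym (at-ρ i (state Φ) k₁)) (trans (cong (λ Ψ → at (state Ψ) k₁) e) (at-ρ j (state Φ) k₁)))
    ; commute    = λ i j Φ far → flag-≡ (ρ-commutes i j (state Φ) far)
    ; transitive = between
    }

  label : FlagOf → Bool
  label = proj₁ ∘ state

  -- A letter changes every label by the same `δ i xor_`, so testing a word at `start` decides
  -- whether it preserves labels everywhere.
  Even : List (Fin n) → Set
  Even h = proj₁ (walk ρ h start) ≡ false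

  -- For even h the table of h g is that of g precomposed with h.
  prefix-even : ∀ h {g g′} → Even h → walk ρ g start ≡ walk ρ g′ start →
                walk ρ (h ++ g) start ≡ walk ρ (h ++ g′) start
  prefix-even h {g} {g′} even e = at-injective λ k →
    trans (at-prefix g k) (trans (cong (λ s → at s (index (proj₂ (at (walk ρ h start) k)))) e) (sym (at-prefix g′ k)))
    where
    open ≡-Reasoning
    at-prefix : ∀ v k → at (walk ρ (h ++ v) start) k ≡ at (walk ρ v start) (index (proj₂ (at (walk ρ h start) k)))
    at-prefix v k = begin
      at (walk ρ (h ++ v) start) k               ≡⟨ cong (λ s → at s k) (walk-++ ρ h v start) ⟩
      at (walk ρ v (walk ρ h start)) k           ≡⟨ at-walk v (walk ρ h start) k ⟩
      walk move v (at (walk ρ h start) k)        ≡⟨ cong (λ l → walk move v (l , x)) even ⟩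
      walk move v (false , x)                    ≡⟨ cong (walk move v) (at-start x) ⟨
      walk move v (at start (index x))           ≡⟨ at-walk v start (index x) ⟨
      at (walk ρ v start) (index x)              ∎
      where x = proj₂ (at (walk ρ h start) k)

  -- Left multiplication, taking the coset H g to H h g. It is computed on the representative
  -- `word Φ`; for even `h`, which normalises H, `translate-via` shows that any other representative
  -- gives the same flag.
  translate : List (Fin n) → FlagOf → FlagOf
  translate h Φ = arrive (h ++ word Φ)

  translate-via : ∀ h v Φ → Even h → walk ρ v start ≡ state Φ → translate h Φ ≡ arrive (h ++ v)
  translate-via h v Φ even e = flag-≡ (prefix-even h even (trans (word-reaches Φ) (sym e)))

  translate-inverse : ∀ h h′ → Even h → walk ρ (h ++ h′) start ≡ start → ∀ Φ → translate h (translate h′ Φ) ≡ Φ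
  translate-inverse h h′ even cancel Φ =
    trans (translate-via h (h′ ++ word Φ) (translate h′ Φ) even refl) (flag-≡ (begin
      walk ρ (h ++ (h′ ++ word Φ)) start        ≡⟨ cong (λ v → walk ρ v start) (List.++-assoc h h′ (word Φ)) ⟨
      walk ρ ((h ++ h′) ++ word Φ) start        ≡⟨ walk-++ ρ (h ++ h′) (word Φ) start ⟩
      walk ρ (word Φ) (walk ρ (h ++ h′) start)  ≡⟨ cong (walk ρ (word Φ)) cancel ⟩
      walk ρ (word Φ) start                     ≡⟨ word-reaches Φ ⟩
      state Φ                                   ∎))
    where open ≡-Reasoning

  cancelʳ : ∀ h → walk ρ (h ++ reverse h) start ≡ start
  cancelʳ h = trans (walk-++ ρ h (reverse h) start) (ρInv.walk-reverse h start)

  cancelˡ : ∀ h → walk ρ (reverse h ++ h) start ≡ start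
  cancelˡ h = trans (walk-++ ρ (reverse h) h start) (ρInv.walk-unreverse h start)

  walk-label : ∀ v {s t} → proj₁ s ≡ proj₁ t → proj₁ (walk ρ v s) ≡ proj₁ (walk ρ v t)
  walk-label []      e = e
  walk-label (i ∷ v) e = walk-label v (cong (δ i xor_) e)

  even-reverse : ∀ h → Even h → Even (reverse h)
  even-reverse h even = trans (walk-label (reverse h) (sym even)) (cong proj₁ (ρInv.walk-reverse h start))

  -- Left multiplication commutes with appending a letter on the right. The word chosen for
  -- `adjacent i Φ` may differ from `word Φ ++ [ i ]`, hence the appeal to `translate-via`.
  translation : ∀ h → Even h → Automorphism maniplex
  translation h even = record
    { to        = translate h
    ; from      = translate (reverse h)
    ; to-from   = translate-inverse h (reverse h) even (cancelʳ h)
    ; from-to   = translate-inverse (reverse h) h (even-reverse h even) (cancelˡ h)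
    ; preserves = λ i Φ → trans
        (translate-via h (word Φ ++ [ i ]) (adjacent i Φ) even
          (trans (walk-++ ρ (word Φ) [ i ] start) (cong (ρ i) (word-reaches Φ))))
        (flag-≡ (trans (cong (λ v → walk ρ v start) (sym (List.++-assoc h (word Φ) [ i ])))
                       (walk-++ ρ (h ++ word Φ) [ i ] start)))
    }

  -- With u leading to Φ and v to Ψ, the element v u⁻¹ carries H u to H v. It preserves labels
  -- because u and v end at the same label.
  same-label⇒same-orbit : ∀ Φ Ψ → label Φ ≡ label Ψ → SameOrbit maniplex Φ Ψ
  same-label⇒same-orbit Φ Ψ e = translation h even , flag-≡ (begin
    walk ρ ((v ++ reverse u) ++ u) start   ≡⟨ cong (λ t → walk ρ t start) (List.++-assoc v (reverse u) u) ⟩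
    walk ρ (v ++ (reverse u ++ u)) start   ≡⟨ walk-++ ρ v (reverse u ++ u) start ⟩
    walk ρ (reverse u ++ u) (walk ρ v start) ≡⟨ walk-++ ρ (reverse u) u _ ⟩
    walk ρ u (walk ρ (reverse u) (walk ρ v start)) ≡⟨ ρInv.walk-unreverse u _ ⟩
    walk ρ v start                         ≡⟨ word-reaches Ψ ⟩
    state Ψ                                ∎)
    where
    open ≡-Reasoning
    u = word Φ
    v = word Ψ
    h = v ++ reverse u
    even : Even h
    even = begin
      proj₁ (walk ρ (v ++ reverse u) start)           ≡⟨ cong proj₁ (walk-++ ρ v (reverse u) start) ⟩
      proj₁ (walk ρ (reverse u) (walk ρ v start))     ≡⟨ walk-label (reverse u) (begin
         proj₁ (walk ρ v start) ≡⟨ cong proj₁ (word-reaches Ψ) ⟩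
         label Ψ                ≡⟨ e ⟨
         label Φ                ≡⟨ cong proj₁ (word-reaches Φ) ⟨
         proj₁ (walk ρ u start) ∎) ⟩
      proj₁ (walk ρ (reverse u) (walk ρ u start))     ≡⟨ cong proj₁ (ρInv.walk-reverse u start) ⟩
      false                                           ∎

  w-fixes-flag : ∀ Φ → label Φ ≡ false → walk adjacent w Φ ≡ Φ
  w-fixes-flag Φ@(flag (.false , f) _) refl = flag-≡ (trans (state-walk w Φ)
    (at-injective λ k → trans (at-walk w (false , f) k) (w-fixes (lookup f k))))

  -- The entries of a flag run through all points with its label, since the word leading there acts
  -- bijectively. Tracing `(true , x₀)` back along this word to `start` finds the entry that holds
  -- it, and `w` moves that entry.
  w-moves-flag : ∀ Φ → label Φ ≡ true → walk adjacent w Φ ≢ Φ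
  w-moves-flag Φ l≡true e = w-moves (subst (λ y → walk move w y ≡ y) at-k fixed)
    where
    open ≡-Reasoning
    v = word Φ
    y = walk move (reverse v) (true , x₀)
    k = index (proj₂ y)
    y-label : proj₁ y ≡ false
    y-label = begin
      proj₁ y                                      ≡⟨ labels (reverse v) (trans (sym l≡true) (cong proj₁ (sym (word-reaches Φ)))) ⟩
      proj₁ (walk ρ (reverse v) (walk ρ v start))  ≡⟨ cong proj₁ (ρInv.walk-reverse v start) ⟩
      false                                        ∎
      where
      labels : ∀ v {y s} → proj₁ y ≡ proj₁ s → proj₁ (walk move v y) ≡ proj₁ (walk ρ v s)
      labels []      p = p
      labels (i ∷ v) p = labels v (trans (move-label i _ _) (cong (δ i xor_) p))
    at-k : at (state Φ) k ≡ (true , x₀)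
    at-k = begin
      at (state Φ) k               ≡⟨ cong (λ s → at s k) (word-reaches Φ) ⟨
      at (walk ρ v start) k        ≡⟨ at-walk v start k ⟩
      walk move v (at start k)     ≡⟨ cong (walk move v) (trans (at-start (proj₂ y)) (cong (_, proj₂ y) (sym y-label))) ⟩
      walk move v y                ≡⟨ MoveInv.walk-unreverse v (true , x₀) ⟩
      (true , x₀)                  ∎
    fixed : walk move w (at (state Φ) k) ≡ at (state Φ) k
    fixed = begin
      walk move w (at (state Φ) k)        ≡⟨ at-walk w (state Φ) k ⟨
      at (walk ρ w (state Φ)) k           ≡⟨ cong (λ s → at s k) (state-walk w Φ) ⟨
      at (state (walk adjacent w Φ)) k    ≡⟨ cong (λ Ψ → at (state Ψ) k) e ⟩
      at (state Φ) k                      ∎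

  to-walk : (α : Automorphism maniplex) → ∀ v Φ → to α (walk adjacent v Φ) ≡ walk adjacent v (to α Φ)
  to-walk α []      Φ = refl
  to-walk α (i ∷ v) Φ = trans (to-walk α v (adjacent i Φ)) (cong (walk adjacent v) (preserves α i Φ))

  -- Automorphisms commute with the action of `w`, so being fixed by `w` is constant on orbits; it
  -- holds exactly for the flags labelled false.
  same-orbit⇒same-label : ∀ Φ Ψ → SameOrbit maniplex Φ Ψ → label Φ ≡ label Ψ
  same-orbit⇒same-label Φ Ψ (α , refl) with label Φ in p | label (to α Φ) in q
  ... | false | false = refl
  ... | true  | true  = refl
  ... | false | true  = contradiction
    (trans (sym (to-walk α w Φ)) (cong (to α) (w-fixes-flag Φ p)))
    (w-moves-flag (to α Φ) q)
  ... | true  | false = contradiction (begin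
      walk adjacent w Φ                       ≡⟨ from-to α _ ⟨
      from α (to α (walk adjacent w Φ))       ≡⟨ cong (from α) (to-walk α w Φ) ⟩
      from α (walk adjacent w (to α Φ))       ≡⟨ cong (from α) (w-fixes-flag (to α Φ) q) ⟩
      from α (to α Φ)                         ≡⟨ from-to α Φ ⟩
      Φ                                       ∎)
    (w-moves-flag Φ p)
    where open ≡-Reasoning

-- w² rather than w has to move x₀, because only w² is sure to fix the parity vectors of `marked`.
record Gadget {n : ℕ} (δ : Fin n → Bool) : Set₁ where
  field
    action   : Action δ
  open Action action public
  field
    w        : List (Fin n)
    w-fixes  : ∀ x → walk move w (false , x) ≡ (false , x)
    x₀       : Point
    w²-moves : walk move (w ++ w) (true , x₀) ≢ (true , x₀)

-- Parity vectors and the maniplex of a gadget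

toggle : {n : ℕ} → Fin n → Vec Bool n → Vec Bool n
toggle i s = updateAt s i not

toggle-involutive : ∀ {n} (i : Fin n) s → toggle i (toggle i s) ≡ s
toggle-involutive i s = trans (Vec.updateAt-updateAt i s) (Vec.updateAt-id-local i s (Bool.not-involutive _))

toggle-commutes : ∀ {n} (i j : Fin n) s → toggle i (toggle j s) ≡ toggle j (toggle i s)
toggle-commutes i j s with i Fin.≟ j
... | yes refl = refl
... | no i≢j   = Vec.updateAt-commutes i j i≢j s

toggle-lookup : ∀ {n} (i : Fin n) s → lookup (toggle i s) i ≡ not (lookup s i)
toggle-lookup i s = Vec.lookup∘updateAt i s

toggle-free : ∀ {n} (i : Fin n) s → toggle i s ≢ s
toggle-free i s e = Bool.not-¬ refl (trans (cong (λ t → lookup t i) (sym e)) (toggle-lookup i s))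

toggle-distinct : ∀ {n} (i j : Fin n) s → i ≢ j → toggle i s ≢ toggle j s
toggle-distinct i j s i≢j e = Bool.not-¬ refl (begin
  lookup s i                ≡⟨ Vec.lookup∘updateAt′ i j i≢j s ⟨
  lookup (toggle j s) i     ≡⟨ cong (λ t → lookup t i) e ⟨
  lookup (toggle i s) i     ≡⟨ toggle-lookup i s ⟩
  not (lookup s i)          ∎)
  where open ≡-Reasoning

walk-toggle : ∀ {n} (v : List (Fin n)) i s → walk toggle v (toggle i s) ≡ toggle i (walk toggle v s)
walk-toggle []      i s = refl
walk-toggle (j ∷ v) i s = trans (cong (walk toggle v) (toggle-commutes j i s)) (walk-toggle v i (toggle j s))

-- Toggles commute, so each one in the first copy of the word cancels against its repetition in the
-- second.
walk-toggle-twice : ∀ {n} (v : List (Fin n)) s → walk toggle v (walk toggle v s) ≡ s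
walk-toggle-twice []      s = refl
walk-toggle-twice (i ∷ v) s = begin
  walk toggle v (toggle i (walk toggle v (toggle i s)))  ≡⟨ walk-toggle v i _ ⟩
  toggle i (walk toggle v (walk toggle v (toggle i s)))  ≡⟨ cong (toggle i) (walk-toggle-twice v (toggle i s)) ⟩
  toggle i (toggle i s)                                  ≡⟨ toggle-involutive i s ⟩
  s                                                      ∎
  where open ≡-Reasoning

module _ {n : ℕ} {δ : Fin n → Bool} (A : Action δ) where
  open Action A

  marked-move : Fin n → Bool × (Point × Vec Bool n) → Bool × (Point × Vec Bool n)
  marked-move i (l , x , s) = proj₁ (move i (l , x)) , proj₂ (move i (l , x)) , toggle i s

  walk-marked : ∀ v l x s → let y = walk move v (l , x) in
                walk marked-move v (l , x , s) ≡ (proj₁ y , proj₂ y , walk toggle v s)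
  walk-marked []      l x s = refl
  walk-marked (i ∷ v) l x s = walk-marked v _ _ (toggle i s)

  marked : Action δ
  marked = record
    { Point           = Point × Vec Bool n
    ; finite          = finite-× finite (finite-Vec finite-Bool n)
    ; move            = marked-move
    ; move-label      = λ { i l (x , s) → move-label i l x }
    ; move-involutive = λ { i (l , x , s) → cong₂ unmark (move-involutive i (l , x)) (toggle-involutive i s) }
    ; move-commutes   = λ { i j (l , x , s) far → cong₂ unmark (move-commutes i j (l , x) far) (toggle-commutes i j s) }
    }
    where
    unmark : Bool × Point → Vec Bool n → Bool × (Point × Vec Bool n)
    unmark (l , x) s = l , x , s

∉⇒swaps : ∀ {n} (I : Subset n) {i} → i ∉ I → not (lookup I i) ≡ true
∉⇒swaps I {i} i∉I with lookup I i in e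
... | true  = contradiction (Vec.lookup⇒[]= i I e) i∉I
... | false = refl

gadget⇒maniplex : ∀ {n} (I : Subset n) → (∃ λ i → i ∉ I) → Gadget (not ∘ lookup I) →
                  ∃ λ (M : Maniplex n) → IsOfType2 I M
gadget⇒maniplex {n} I (k₀ , k₀∉I) G = C.maniplex , C.label ,
  (λ Φ Ψ → mk⇔ (C.same-orbit⇒same-label Φ Ψ) (C.same-label⇒same-orbit Φ Ψ)) ,
  (λ { false → C.arrive [] , refl
     -- Properness of `I` enters here: a colour outside it leads from `start` to the second label.
     ; true  → C.arrive [ k₀ ] , cong (_xor false) (swaps k₀∉I) }) ,
  λ i Φ → (λ i∈I → cong (_xor C.label Φ) (keeps i∈I)) ,
          (λ i∉I e → Bool.not-¬ refl (sym (trans (cong (_xor C.label Φ) (sym (swaps i∉I))) e)))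
  where
  open Gadget G
  keeps : ∀ {i} → i ∈ I → not (lookup I i) ≡ false
  keeps i∈I = cong not (Vec.[]=⇒lookup i∈I)
  swaps : ∀ {i} → i ∉ I → not (lookup I i) ≡ true
  swaps = ∉⇒swaps I
  s₀ : Vec Bool n
  s₀ = Vec.replicate n false
  free : ∀ i y → marked-move action i y ≢ y
  free i (l , x , s) e = toggle-free i s (cong (proj₂ ∘ proj₂) e)
  adjacent-distinct : ∀ i j y → i ≢ j → marked-move action i y ≢ marked-move action j y
  adjacent-distinct i j (l , x , s) i≢j e = toggle-distinct i j s i≢j (cong (proj₂ ∘ proj₂) e)
  w²-fixes : ∀ y → walk (marked-move action) (w ++ w) (false , y) ≡ (false , y)
  w²-fixes (x , s) = trans (walk-marked action (w ++ w) false x s) (cong₂ (λ y t → proj₁ y , proj₂ y , t)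
    (trans (walk-++ move w w _) (trans (cong (walk move w) (w-fixes x)) (w-fixes x)))
    (trans (walk-++ toggle w w s) (walk-toggle-twice w s)))
  w²-moves-marked : walk (marked-move action) (w ++ w) (true , x₀ , s₀) ≢ (true , x₀ , s₀)
  w²-moves-marked e =
    w²-moves (cong (λ y → proj₁ y , proj₁ (proj₂ y)) (trans (sym (walk-marked action (w ++ w) true x₀ s₀)) e))
  module C = Construction (marked action) free adjacent-distinct (w ++ w) w²-fixes (x₀ , s₀) w²-moves-marked

-- Adjoining colours that act trivially

extend : ∀ {n m} {δ : Fin n → Bool} {δ′ : Fin m → Bool}
         (κ : Fin n → Maybe (Fin m)) (ι : Fin m → Fin n) →
         (∀ e → κ (ι e) ≡ just e) →
         (∀ i → δ i ≡ maybe′ δ′ false (κ i)) →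
         (∀ i j e f → κ i ≡ just e → κ j ≡ just f → Far i j → Far e f) →
         Gadget δ′ → Gadget δ
extend {n} {m} {δ} {δ′} κ ι κι δ-κ far-κ G = record
  { action   = record
    { Point           = Point
    ; finite          = finite
    -- Colours sent to `nothing` act as the identity. They must therefore keep labels, whence the
    -- default `false` in the hypothesis on `δ`, and they commute with everything.
    ; move            = perform ∘ κ
    ; move-label      = λ i l x → trans (perform-label (κ i) l x) (cong (_xor l) (sym (δ-κ i)))
    ; move-involutive = λ i → perform-involutive (κ i)
    ; move-commutes   = λ i j y far → perform-commutes (κ i) (κ j) y λ e f p q → far-κ i j e f p q far
    }
  ; w        = map ι w
  ; w-fixes  = λ x → trans (walk-ι w (false , x)) (w-fixes x)
  ; x₀       = x₀
  ; w²-moves = λ e → w²-moves (trans (sym (walk-ι (w ++ w) (true , x₀)))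
                 (trans (cong (λ v → walk (perform ∘ κ) v (true , x₀)) (List.map-++ ι w w)) e))
  }
  where
  open Gadget G
  perform : Maybe (Fin m) → Bool × Point → Bool × Point
  perform = maybe′ move id
  perform-label : ∀ e l x → proj₁ (perform e (l , x)) ≡ maybe′ δ′ false e xor l
  perform-label (just e) l x = move-label e l x
  perform-label nothing  l x = refl
  perform-involutive : ∀ e y → perform e (perform e y) ≡ y
  perform-involutive (just e) y = move-involutive e y
  perform-involutive nothing  y = refl
  perform-commutes : ∀ p q y → (∀ e f → p ≡ just e → q ≡ just f → Far e f) → perform p (perform q y) ≡ perform q (perform p y)
  perform-commutes nothing  q        y far = refl
  perform-commutes (just e) nothing  y far = refl
  perform-commutes (just e) (just f) y far = move-commutes e f y (far e f refl refl)
  walk-ι : ∀ v y → walk (perform ∘ κ) (map ι v) y ≡ walk move v y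
  walk-ι []      y = refl
  walk-ι (i ∷ v) y = trans (cong (λ e → walk (perform ∘ κ) (map ι v) (perform e y)) (κι i)) (walk-ι v (move i y))

-- Needed because a function agrees with the `lookup` of its own table only pointwise.
extend-≗ : ∀ {n} {δ δ′ : Fin n → Bool} → δ ≗ δ′ → Gadget δ′ → Gadget δ
extend-≗ e = extend just id (λ _ → refl) e λ { i j .i .j refl refl far → far }

extend-front : ∀ {n} {δ : Fin (suc n) → Bool} → δ zero ≡ false → Gadget (δ ∘ suc) → Gadget δ
extend-front {n} {δ} δ₀ = extend κ suc (λ _ → refl) (λ { zero → δ₀ ; (suc i) → refl })
  λ { (suc i) (suc j) .i .j refl refl far → far }
  where
  κ : Fin (suc n) → Maybe (Fin n)
  κ zero    = nothing
  κ (suc i) = just i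

extend-back : ∀ {n} {δ : Fin (suc n) → Bool} → δ (fromℕ n) ≡ false → Gadget (δ ∘ inject₁) → Gadget δ
extend-back {n} {δ} δ-last =
  extend κ inject₁ (λ e → cong κ′ (view-inject₁ e)) (λ i → δ-κ (view i))
    λ i j e f p q far → subst₂ (λ a b → 2 ≤ ∣ a - b ∣) (κ-toℕ (view i) p) (κ-toℕ (view j) q) far
  where
  κ′ : {i : Fin (suc n)} → View i → Maybe (Fin n)
  κ′ ‵fromℕ          = nothing
  κ′ (‵inj₁ {i = i} _) = just i
  κ : Fin (suc n) → Maybe (Fin n)
  κ i = κ′ (view i)
  δ-κ : {i : Fin (suc n)} (v : View i) → δ i ≡ maybe′ (δ ∘ inject₁) false (κ′ v)
  δ-κ ‵fromℕ    = δ-last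
  δ-κ (‵inj₁ _) = refl
  κ-toℕ : {i : Fin (suc n)} {e : Fin n} (v : View i) → κ′ v ≡ just e → toℕ i ≡ toℕ e
  κ-toℕ (‵inj₁ {i = i} _) refl = Fin.toℕ-inject₁ i

-- Rank three

-- A letter that exchanges the labels is an involution when its two permutations are mutually
-- inverse, one that keeps them when each permutation is an involution. In every table below exactly
-- one letter treats the labels differently, and it lies outside I.
module Table (δ : Fin 3 → Bool) (perms : Bool → Vec (Vec (Fin 5) 5) 3) where

  table-move : Fin 3 → Bool × Fin 5 → Bool × Fin 5
  table-move i (l , x) = δ i xor l , lookup (lookup (perms l) i) x

  _≟_ : DecidableEquality (Bool × Fin 5)
  _≟_ = Product.≡-dec Bool._≟_ Fin._≟_

  all-points? : {P : Bool × Fin 5 → Set} → (∀ y → Dec (P y)) → Dec (∀ y → P y)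
  all-points? P? = map′ (λ { (p , q) (false , x) → p x ; (p , q) (true , x) → q x })
                        (λ p → (λ x → p (false , x)) , λ x → p (true , x))
                        (all? (λ x → P? (false , x)) ×-dec all? (λ x → P? (true , x)))

  involutive? : Dec (∀ i y → table-move i (table-move i y) ≡ y)
  involutive? = all? λ i → all-points? λ y → table-move i (table-move i y) ≟ y

  commutes? : Dec (∀ i j → Far i j → ∀ y → table-move i (table-move j y) ≡ table-move j (table-move i y))
  commutes? = all? λ i → all? λ j → (2 ≤? ∣ toℕ i - toℕ j ∣) →-dec
    all-points? λ y → table-move i (table-move j y) ≟ table-move j (table-move i y)

  fixes? : ∀ w → Dec (∀ x → walk table-move w (false , x) ≡ (false , x))
  fixes? w = all? λ x → walk table-move w (false , x) ≟ (false , x)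

  table-gadget : ∀ w x₀ {_ : True involutive?} {_ : True commutes?} {_ : True (fixes? w)}
                 {_ : False (walk table-move (w ++ w) (true , x₀) ≟ (true , x₀))} → Gadget δ
  table-gadget w x₀ {inv} {com} {fix} {mov} = record
    { action   = record
      { Point           = Fin 5
      ; finite          = 5 , ↔-id _
      ; move            = table-move
      ; move-label      = λ _ _ _ → refl
      ; move-involutive = toWitness inv
      ; move-commutes   = λ i j y far → toWitness com i j far y
      }
    ; w        = w
    ; w-fixes  = toWitness fix
    ; x₀       = x₀
    ; w²-moves = toWitnessFalse mov
    }

⟨01⟩ ⟨03⟩ ⟨12⟩ ⟨13⟩ ⟨012⟩ ⟨021⟩ ⟨234⟩ ⟨243⟩ ⟨1234⟩ ⟨1432⟩ ⟨01|23⟩ ⟨01|34⟩ ⟨02|13⟩ ⟨13|24⟩ ⟨01|234⟩ ⟨01|243⟩ : Vec (Fin 5) 5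
⟨01⟩     = 1F ∷ 0F ∷ 2F ∷ 3F ∷ 4F ∷ []
⟨03⟩     = 3F ∷ 1F ∷ 2F ∷ 0F ∷ 4F ∷ []
⟨12⟩     = 0F ∷ 2F ∷ 1F ∷ 3F ∷ 4F ∷ []
⟨13⟩     = 0F ∷ 3F ∷ 2F ∷ 1F ∷ 4F ∷ []
⟨012⟩    = 1F ∷ 2F ∷ 0F ∷ 3F ∷ 4F ∷ []
⟨021⟩    = 2F ∷ 0F ∷ 1F ∷ 3F ∷ 4F ∷ []
⟨234⟩    = 0F ∷ 1F ∷ 3F ∷ 4F ∷ 2F ∷ []
⟨243⟩    = 0F ∷ 1F ∷ 4F ∷ 2F ∷ 3F ∷ []
⟨1234⟩   = 0F ∷ 2F ∷ 3F ∷ 4F ∷ 1F ∷ []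
⟨1432⟩   = 0F ∷ 4F ∷ 1F ∷ 2F ∷ 3F ∷ []
⟨01|23⟩  = 1F ∷ 0F ∷ 3F ∷ 2F ∷ 4F ∷ []
⟨01|34⟩  = 1F ∷ 0F ∷ 2F ∷ 4F ∷ 3F ∷ []
⟨02|13⟩  = 2F ∷ 3F ∷ 0F ∷ 1F ∷ 4F ∷ []
⟨13|24⟩  = 0F ∷ 3F ∷ 4F ∷ 1F ∷ 2F ∷ []
⟨01|234⟩ = 1F ∷ 0F ∷ 3F ∷ 4F ∷ 2F ∷ []
⟨01|243⟩ = 1F ∷ 0F ∷ 4F ∷ 2F ∷ 3F ∷ []

-- The permutations and words were found by a computer search.
triple-gadget : (v : Vec Bool 3) (i : Fin 3) → lookup v i ≡ true → Gadget (lookup v)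
triple-gadget (false ∷ false ∷ false ∷ []) 0F ()
triple-gadget (false ∷ false ∷ false ∷ []) 1F ()
triple-gadget (false ∷ false ∷ false ∷ []) 2F ()
triple-gadget v@(false ∷ false ∷ true ∷ []) _ _ = Table.table-gadget (lookup v)
  (λ { false → ⟨13|24⟩ ∷ ⟨01|34⟩ ∷ ⟨1234⟩ ∷ []
     ; true  → ⟨13|24⟩ ∷ ⟨01|34⟩ ∷ ⟨1432⟩ ∷ [] })
  (0F ∷ 1F ∷ 2F ∷ 1F ∷ 2F ∷ 1F ∷ []) 0F
triple-gadget v@(false ∷ true ∷ false ∷ []) _ _ = Table.table-gadget (lookup v)
  (λ { false → ⟨12⟩ ∷ ⟨01|234⟩ ∷ ⟨03⟩ ∷ []
     ; true  → ⟨12⟩ ∷ ⟨01|243⟩ ∷ ⟨03⟩ ∷ [] })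
  (0F ∷ 1F ∷ 2F ∷ 1F ∷ []) 1F
triple-gadget v@(false ∷ true ∷ true ∷ []) _ _ = Table.table-gadget (lookup v)
  (λ { false → ⟨02|13⟩ ∷ ⟨234⟩ ∷ ⟨13⟩ ∷ []
     ; true  → ⟨02|13⟩ ∷ ⟨243⟩ ∷ ⟨13⟩ ∷ [] })
  (0F ∷ 1F ∷ 0F ∷ 1F ∷ 2F ∷ 1F ∷ 0F ∷ 2F ∷ 1F ∷ []) 0F
triple-gadget v@(true ∷ false ∷ false ∷ []) _ _ = Table.table-gadget (lookup v)
  (λ { false → ⟨1234⟩ ∷ ⟨01|34⟩ ∷ ⟨13|24⟩ ∷ []
     ; true  → ⟨1432⟩ ∷ ⟨01|34⟩ ∷ ⟨13|24⟩ ∷ [] })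
  (0F ∷ 1F ∷ 0F ∷ 1F ∷ 2F ∷ 1F ∷ []) 0F
triple-gadget v@(true ∷ false ∷ true ∷ []) _ _ = Table.table-gadget (lookup v)
  (λ { false → ⟨012⟩ ∷ ⟨12⟩ ∷ ⟨01⟩ ∷ []
     ; true  → ⟨021⟩ ∷ ⟨12⟩ ∷ ⟨01⟩ ∷ [] })
  (0F ∷ 2F ∷ 1F ∷ []) 0F
triple-gadget v@(true ∷ true ∷ false ∷ []) _ _ = Table.table-gadget (lookup v)
  (λ { false → ⟨1234⟩ ∷ ⟨01|34⟩ ∷ ⟨13|24⟩ ∷ []
     ; true  → ⟨1432⟩ ∷ ⟨01|34⟩ ∷ ⟨13|24⟩ ∷ [] })
  (0F ∷ 1F ∷ 0F ∷ 1F ∷ 2F ∷ 1F ∷ 2F ∷ 1F ∷ 2F ∷ []) 0F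
triple-gadget v@(true ∷ true ∷ true ∷ []) _ _ = Table.table-gadget (lookup v)
  (λ { false → ⟨234⟩ ∷ ⟨12⟩ ∷ ⟨01|23⟩ ∷ []
     ; true  → ⟨243⟩ ∷ ⟨12⟩ ∷ ⟨01|23⟩ ∷ [] })
  (0F ∷ 1F ∷ 0F ∷ 1F ∷ 2F ∷ 1F ∷ 0F ∷ 2F ∷ 1F ∷ 2F ∷ []) 0F

-- Chains: ranks above three

-- Pairs aₖ = pair false k and bₖ = pair true k for k ≤ N, together with the point C.  The last letter
-- rotates a_N, b_N, C; every other letter e exchanges the neighbouring pairs e and e + 1 and, if it
-- lies outside I, exchanges a and b in all later pairs, which makes it commute with the letters there.
Chain : ℕ → Set
Chain N = Unit ⊎ Bool × Fin (suc N)

pattern hub      = inj₁ tt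
pattern pair s k = inj₂ (s , k)

lift : ∀ {N} → Chain N → Chain (suc N)
lift hub        = hub
lift (pair s k) = pair s (suc k)

mirror : ∀ {N} → Bool → Chain N → Chain N
mirror b hub        = hub
mirror b (pair s k) = pair (b xor s) k

-- The recursion drops the first letter together with the first pair. The label matters for the last
-- letter only, whose rotation from label true is the inverse of the one from label false.
link : ∀ {N} → (Fin (suc N) → Bool) → Fin (suc N) → Bool → Chain N → Chain N
link {zero}  δ 0F false (pair false 0F) = pair true 0F
link {zero}  δ 0F false (pair true 0F)  = hub
link {zero}  δ 0F false hub             = pair false 0F
link {zero}  δ 0F true  (pair false 0F) = hub
link {zero}  δ 0F true  (pair true 0F)  = pair false 0F
link {zero}  δ 0F true  hub             = pair true 0F
link {suc N} δ 0F l     hub             = hub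
link {suc N} δ 0F l (pair s 0F)            = pair s 1F
link {suc N} δ 0F l (pair s 1F)            = pair s 0F
link {suc N} δ 0F l (pair s (suc (suc k))) = pair (δ 0F xor s) (suc (suc k))
link {suc N} δ (suc e) l hub               = lift (link (δ ∘ suc) e l hub)
link {suc N} δ (suc e) l (pair s 0F)       = pair s 0F
link {suc N} δ (suc e) l (pair s (suc k))  = lift (link (δ ∘ suc) e l (pair s k))

link-lift : ∀ {N} (δ : Fin (suc (suc N)) → Bool) e l x → link δ (suc e) l (lift x) ≡ lift (link (δ ∘ suc) e l x)
link-lift δ e l hub        = refl
link-lift δ e l (pair s k) = refl

mirror-lift : ∀ {N} b (x : Chain N) → mirror b (lift x) ≡ lift (mirror b x)
mirror-lift b hub        = refl
mirror-lift b (pair s k) = refl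

xor-swap : ∀ a b c → a xor (b xor c) ≡ b xor (a xor c)
xor-swap false b     c = refl
xor-swap true  false c = refl
xor-swap true  true  c = refl

xor-cancel : ∀ b c → b xor (b xor c) ≡ c
xor-cancel false c = refl
xor-cancel true  c = Bool.not-involutive c

-- Exchanging a and b conjugates the rotation of a, b and the hub into its inverse, which is also
-- the effect of changing the label. This is why a letter that changes the label has to mirror the
-- later pairs.
link-mirror : ∀ {N} (δ : Fin (suc N) → Bool) e b l x → link δ e (b xor l) (mirror b x) ≡ mirror b (link δ e l x)
link-mirror {zero} δ 0F false false hub             = refl
link-mirror {zero} δ 0F false true  hub             = refl
link-mirror {zero} δ 0F true  false hub             = refl
link-mirror {zero} δ 0F true  true  hub             = refl
link-mirror {zero} δ 0F false false (pair false 0F) = refl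
link-mirror {zero} δ 0F false false (pair true 0F)  = refl
link-mirror {zero} δ 0F false true  (pair false 0F) = refl
link-mirror {zero} δ 0F false true  (pair true 0F)  = refl
link-mirror {zero} δ 0F true  false (pair false 0F) = refl
link-mirror {zero} δ 0F true  false (pair true 0F)  = refl
link-mirror {zero} δ 0F true  true  (pair false 0F) = refl
link-mirror {zero} δ 0F true  true  (pair true 0F)  = refl
link-mirror {suc N} δ 0F b l hub                    = refl
link-mirror {suc N} δ 0F b l (pair s 0F)            = refl
link-mirror {suc N} δ 0F b l (pair s 1F)            = refl
link-mirror {suc N} δ 0F b l (pair s (suc (suc k))) = cong (λ t → pair t (suc (suc k))) (xor-swap (δ 0F) b s)
link-mirror {suc N} δ (suc e) b l hub               =
  trans (cong lift (link-mirror (δ ∘ suc) e b l hub)) (sym (mirror-lift b (link (δ ∘ suc) e l hub)))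
link-mirror {suc N} δ (suc e) b l (pair s 0F)       = refl
link-mirror {suc N} δ (suc e) b l (pair s (suc k))  =
  trans (cong lift (link-mirror (δ ∘ suc) e b l (pair s k))) (sym (mirror-lift b (link (δ ∘ suc) e l (pair s k))))

-- The last letter rotates three points, so it is an involution by virtue of exchanging the labels,
-- between which the rotations are inverse.
link-involutive : ∀ {N} (δ : Fin (suc N) → Bool) → δ (fromℕ N) ≡ true → ∀ e l x →
                  link δ e (δ e xor l) (link δ e l x) ≡ x
link-involutive {zero} δ top 0F l x rewrite top = cyclic l x
  where
  cyclic : ∀ l x → link δ 0F (not l) (link δ 0F l x) ≡ x
  cyclic false hub             = refl
  cyclic false (pair false 0F) = refl
  cyclic false (pair true 0F)  = refl
  cyclic true  hub             = refl
  cyclic true  (pair false 0F) = refl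
  cyclic true  (pair true 0F)  = refl
link-involutive {suc N} δ top 0F l hub                    = refl
link-involutive {suc N} δ top 0F l (pair s 0F)            = refl
link-involutive {suc N} δ top 0F l (pair s 1F)            = refl
link-involutive {suc N} δ top 0F l (pair s (suc (suc k))) = cong (λ t → pair t (suc (suc k))) (xor-cancel (δ 0F) s)
link-involutive {suc N} δ top (suc e) l hub               =
  trans (link-lift δ e _ (link (δ ∘ suc) e l hub)) (cong lift (link-involutive (δ ∘ suc) top e l hub))
link-involutive {suc N} δ top (suc e) l (pair s 0F)       = refl
link-involutive {suc N} δ top (suc e) l (pair s (suc k))  =
  trans (link-lift δ e _ (link (δ ∘ suc) e l (pair s k))) (cong lift (link-involutive (δ ∘ suc) top e l (pair s k)))

link-first-twice-lift : ∀ {N} (δ : Fin (suc (suc (suc N))) → Bool) l x → link δ 0F l (lift (lift x)) ≡ lift (lift (mirror (δ 0F) x))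
link-first-twice-lift δ l hub        = refl
link-first-twice-lift δ l (pair s k) = refl

-- The letter `e` fixes pairs 0 and 1, and beyond them the first letter is just `mirror (δ 0F)`, so
-- `link-mirror` applies.
link-commutes-first : ∀ {N} (δ : Fin (suc (suc (suc N))) → Bool) f l x → let e = suc (suc f) in
  link δ 0F (δ e xor l) (link δ e l x) ≡ link δ e (δ 0F xor l) (link δ 0F l x)
link-commutes-first δ f l (pair s 0F) = refl
link-commutes-first δ f l (pair s 1F) = refl
link-commutes-first δ f l hub =
  trans (link-first-twice-lift δ _ (link ((δ ∘ suc) ∘ suc) f l hub))
        (cong (lift ∘ lift) (sym (link-mirror ((δ ∘ suc) ∘ suc) f (δ 0F) l hub)))
link-commutes-first δ f l (pair s (suc (suc k))) =
  trans (link-first-twice-lift δ _ (link ((δ ∘ suc) ∘ suc) f l (pair s k)))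
        (cong (lift ∘ lift) (sym (link-mirror ((δ ∘ suc) ∘ suc) f (δ 0F) l (pair s k))))

link-commutes : ∀ {N} (δ : Fin (suc N) → Bool) e f l x → Far e f →
                link δ e (δ f xor l) (link δ f l x) ≡ link δ f (δ e xor l) (link δ e l x)
link-commutes {suc (suc N)} δ 0F (suc (suc f)) l x _ = link-commutes-first δ f l x
link-commutes {suc (suc N)} δ (suc (suc f)) 0F l x _ = sym (link-commutes-first δ f l x)
link-commutes {N} δ 0F 1F l x (s≤s ())
link-commutes {N} δ 1F 0F l x (s≤s ())
link-commutes {suc N} δ (suc e) (suc f) l hub far = begin
  link δ (suc e) _ (lift (link δ′ f l hub))  ≡⟨ link-lift δ e _ (link δ′ f l hub) ⟩
  lift (link δ′ e _ (link δ′ f l hub))       ≡⟨ cong lift (link-commutes δ′ e f l hub far) ⟩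
  lift (link δ′ f _ (link δ′ e l hub))       ≡⟨ link-lift δ f _ (link δ′ e l hub) ⟨
  link δ (suc f) _ (lift (link δ′ e l hub))  ∎
  where
  open ≡-Reasoning
  δ′ = δ ∘ suc
link-commutes {suc N} δ (suc e) (suc f) l (pair s 0F) far = refl
link-commutes {suc N} δ (suc e) (suc f) l (pair s (suc k)) far = begin
  link δ (suc e) _ (lift (link δ′ f l x))  ≡⟨ link-lift δ e _ (link δ′ f l x) ⟩
  lift (link δ′ e _ (link δ′ f l x))       ≡⟨ cong lift (link-commutes δ′ e f l x far) ⟩
  lift (link δ′ f _ (link δ′ e l x))       ≡⟨ link-lift δ f _ (link δ′ e l x) ⟨
  link δ (suc f) _ (lift (link δ′ e l x))  ∎
  where
  open ≡-Reasoning
  δ′ = δ ∘ suc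
  x = pair s k

link-joins : ∀ {N} (δ : Fin (suc N) → Bool) e l s → link δ (inject₁ e) l (pair s (inject₁ e)) ≡ pair s (suc e)
link-joins δ 0F      l s = refl
link-joins δ (suc e) l s = cong lift (link-joins (δ ∘ suc) e l s)

link-last-false : ∀ N (δ : Fin (suc N) → Bool) → link δ (fromℕ N) false (pair false (fromℕ N)) ≡ pair true (fromℕ N)
link-last-false zero    δ = refl
link-last-false (suc N) δ = cong lift (link-last-false N (δ ∘ suc))

link-last-true : ∀ N (δ : Fin (suc N) → Bool) → link δ (fromℕ N) true (pair false (fromℕ N)) ≡ hub
link-last-true zero    δ = refl
link-last-true (suc N) δ = cong lift (link-last-true N (δ ∘ suc))

-- The first letter tells a₀ from b₀ by attaching a further point to a₀ only.
Tailed : ℕ → Set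
Tailed N = Unit ⊎ Chain N

pattern tail      = inj₁ tt
pattern inner x   = inj₂ x

-- Mirroring all pairs from 1 on makes this commute with the colours from 2 on, as for a letter of
-- the chain outside I. Colour `suc e` is the letter `e` of `link`, so those colours touch no
-- earlier pair.
tip : ∀ {N} → Tailed N → Tailed N
tip tail                         = inner (pair false 0F)
tip (inner hub)                  = inner hub
tip (inner (pair s 0F))          = if s then inner (pair true 0F) else tail
tip (inner (pair s (suc k)))     = inner (pair (not s) (suc k))

tip-involutive : ∀ {N} (x : Tailed N) → tip (tip x) ≡ x
tip-involutive tail                     = refl
tip-involutive (inner hub)              = refl
tip-involutive (inner (pair false 0F))  = refl
tip-involutive (inner (pair true 0F))   = refl
tip-involutive (inner (pair s (suc k))) = cong (λ t → inner (pair t (suc k))) (Bool.not-involutive s)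

_≟_ : ∀ {N} → DecidableEquality (Tailed N)
_≟_ = Sum.≡-dec Unit._≟_ (Sum.≡-dec Unit._≟_ (Product.≡-dec Bool._≟_ Fin._≟_))

-- Three-cycles and their conjugates

module ThreeCycle {A : Set} (_≟_ : DecidableEquality A) where

  cycle : A → A → A → A → A
  cycle p q r x =
    if does (x ≟ p) then q else if does (x ≟ q) then r else if does (x ≟ r) then p else x

  cycle₁ : ∀ p q r → cycle p q r p ≡ q
  cycle₁ p q r with p ≟ p
  ... | yes _ = refl
  ... | no p≢p = contradiction refl p≢p

  cycle₂ : ∀ {p q} r → q ≢ p → cycle p q r q ≡ r
  cycle₂ {p} {q} r q≢p with q ≟ p | q ≟ q
  ... | yes e | _      = contradiction e q≢p
  ... | no _  | yes _  = refl
  ... | no _  | no q≢q = contradiction refl q≢q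

  cycle₃ : ∀ {p q r} → r ≢ p → r ≢ q → cycle p q r r ≡ p
  cycle₃ {p} {q} {r} r≢p r≢q with r ≟ p | r ≟ q | r ≟ r
  ... | yes e | _     | _      = contradiction e r≢p
  ... | no _  | yes e | _      = contradiction e r≢q
  ... | no _  | no _  | yes _  = refl
  ... | no _  | no _  | no r≢r = contradiction refl r≢r

  cycle-other : ∀ {p q r x} → x ≢ p → x ≢ q → x ≢ r → cycle p q r x ≡ x
  cycle-other {p} {q} {r} {x} x≢p x≢q x≢r with x ≟ p | x ≟ q | x ≟ r
  ... | yes e | _     | _     = contradiction e x≢p
  ... | no _  | yes e | _     = contradiction e x≢q
  ... | no _  | no _  | yes e = contradiction e x≢r
  ... | no _  | no _  | no _  = refl

  -- This serves twice: with `π` a letter it computes conjugates of words, and with `π` a disjoint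
  -- three-cycle it shows that the two cycles commute.
  cycle-conjugate : ∀ (π : A → A) → (∀ {x y} → π x ≡ π y → x ≡ y) → ∀ p q r x →
                    cycle (π p) (π q) (π r) (π x) ≡ π (cycle p q r x)
  cycle-conjugate π inj p q r x with x ≟ p | x ≟ q | x ≟ r
  ... | yes refl | _ | _ = cycle₁ (π p) (π q) (π r)
  ... | no x≢p | yes refl | _ = cycle₂ (π r) (x≢p ∘ inj)
  ... | no x≢p | no x≢q | yes refl = cycle₃ (x≢p ∘ inj) (x≢q ∘ inj)
  ... | no x≢p | no x≢q | no x≢r = cycle-other (x≢p ∘ inj) (x≢q ∘ inj) (x≢r ∘ inj)

  cycle³ : ∀ {p q r} → q ≢ p → r ≢ p → r ≢ q → ∀ x → cycle p q r (cycle p q r (cycle p q r x)) ≡ x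
  cycle³ {p} {q} {r} q≢p r≢p r≢q x with x ≟ p | x ≟ q | x ≟ r
  ... | yes refl | _ | _ = trans (cong (cycle p q r) (cycle₂ r q≢p)) (cycle₃ r≢p r≢q)
  ... | no _ | yes refl | _ = trans (cong (cycle p q r) (cycle₃ r≢p r≢q)) (cycle₁ p q r)
  ... | no _ | no _ | yes refl = trans (cong (cycle p q r) (cycle₁ p q r)) (cycle₂ r q≢p)
  ... | no x≢p | no x≢q | no x≢r = trans (cong (cycle p q r) fixed) fixed
    where fixed = cycle-other x≢p x≢q x≢r

  cycle-injective : ∀ {p q r} → q ≢ p → r ≢ p → r ≢ q → ∀ {x y} → cycle p q r x ≡ cycle p q r y → x ≡ y
  cycle-injective {p} {q} {r} q≢p r≢p r≢q {x} {y} e =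
    trans (sym (cycle³ q≢p r≢p r≢q x)) (trans (cong (cycle p q r ∘ cycle p q r) e) (cycle³ q≢p r≢p r≢q y))

-- The action on a tailed chain

chain-step : ∀ {N} → (Fin (2 + N) → Bool) → Fin (2 + N) → Bool → Tailed N → Tailed N
chain-step δ 0F      l x         = tip x
chain-step δ (suc e) l tail      = tail
chain-step δ (suc e) l (inner x) = inner (link (δ ∘ suc) e l x)

chain-move : ∀ {N} → (Fin (2 + N) → Bool) → Fin (2 + N) → Bool × Tailed N → Bool × Tailed N
chain-move δ i (l , x) = δ i xor l , chain-step δ i l x

-- Found by a computer search.
base : ∀ {N} → Bool → List (Fin (4 + N))
base false = 0F ∷ 1F ∷ 0F ∷ 1F ∷ 0F ∷ 1F ∷ 2F ∷ 1F ∷ 0F ∷ 1F ∷ 0F ∷ 1F ∷ 0F ∷ 2F ∷ []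
base true  = 2F ∷ 1F ∷ 0F ∷ 2F ∷ 1F ∷ 0F ∷ 2F ∷ 1F ∷ 2F ∷ 1F ∷ 0F ∷ 2F ∷ 1F ∷ 0F ∷ 2F ∷ 1F ∷ []

all-Bool³ : {P : Bool → Bool → Bool → Set} →
            P false false false → P false false true → P false true false → P false true true →
            P true false false → P true false true → P true true false → P true true true →
            ∀ x y z → P x y z
all-Bool³ p q r s t u v w false false false = p
all-Bool³ p q r s t u v w false false true  = q
all-Bool³ p q r s t u v w false true  false = r
all-Bool³ p q r s t u v w false true  true  = s
all-Bool³ p q r s t u v w true  false false = t
all-Bool³ p q r s t u v w true  false true  = u
all-Bool³ p q r s t u v w true  true  false = v
all-Bool³ p q r s t u v w true  true  true  = w

-- Each colour occurs an even number of times in either word, so labels and all pairs beyond 2 are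
-- restored; the other points are checked by evaluation. One word serves both values of `d₂`, since
-- colour 2 mirrors only pairs beyond 2.
base-rotates : ∀ {N} (v : Vec Bool (suc N)) x d₁ d₂ l →
               walk (chain-move (lookup (true ∷ d₁ ∷ d₂ ∷ v))) (base d₁) (l , x) ≡
               (l , ThreeCycle.cycle (_≟_ {2 + N}) (inner (pair false 2F)) tail (inner (pair false 1F)) x)
base-rotates v tail = all-Bool³ refl refl refl refl refl refl refl refl
base-rotates v (inner hub) = all-Bool³ refl refl refl refl refl refl refl refl
base-rotates v (inner (pair false 0F)) = all-Bool³ refl refl refl refl refl refl refl refl
base-rotates v (inner (pair true  0F)) = all-Bool³ refl refl refl refl refl refl refl refl
base-rotates v (inner (pair false 1F)) = all-Bool³ refl refl refl refl refl refl refl refl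
base-rotates v (inner (pair true  1F)) = all-Bool³ refl refl refl refl refl refl refl refl
base-rotates v (inner (pair false 2F)) = all-Bool³ refl refl refl refl refl refl refl refl
base-rotates v (inner (pair true  2F)) = all-Bool³ refl refl refl refl refl refl refl refl
base-rotates v (inner (pair false (suc (suc (suc k))))) = all-Bool³ refl refl refl refl refl refl refl refl
base-rotates v (inner (pair true  (suc (suc (suc k))))) = all-Bool³ refl refl refl refl refl refl refl refl

module LongChain {N : ℕ} (d₁ d₂ : Bool) (v : Vec Bool (suc N)) (v-last : lookup v (fromℕ N) ≡ true) where

  δ : Fin (4 + N) → Bool
  δ = lookup (true ∷ d₁ ∷ d₂ ∷ v)

  Pt : Set
  Pt = Tailed (2 + N)

  step-involutive : ∀ i l x → chain-step δ i (δ i xor l) (chain-step δ i l x) ≡ x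
  step-involutive 0F      l x         = tip-involutive x
  step-involutive (suc e) l tail      = refl
  step-involutive (suc e) l (inner x) = cong inj₂ (link-involutive (δ ∘ suc) v-last e l x)

  tip-lift : ∀ (x : Chain (1 + N)) → tip (inner (lift x)) ≡ inner (lift (mirror true x))
  tip-lift hub        = refl
  tip-lift (pair s k) = refl

  step-commutes-first : ∀ e l x → tip (chain-step δ (suc (suc e)) l x) ≡ chain-step δ (suc (suc e)) (not l) (tip x)
  step-commutes-first e l tail                     = refl
  step-commutes-first e l (inner (pair false 0F))  = refl
  step-commutes-first e l (inner (pair true 0F))   = refl
  step-commutes-first e l (inner hub)              =
    trans (tip-lift (link ((δ ∘ suc) ∘ suc) e l hub))
          (cong (inj₂ ∘ lift) (sym (link-mirror ((δ ∘ suc) ∘ suc) e true l hub)))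
  step-commutes-first e l (inner (pair s (suc k))) =
    trans (tip-lift (link ((δ ∘ suc) ∘ suc) e l (pair s k)))
          (cong (inj₂ ∘ lift) (sym (link-mirror ((δ ∘ suc) ∘ suc) e true l (pair s k))))

  step-commutes : ∀ i j l x → Far i j → chain-step δ i (δ j xor l) (chain-step δ j l x) ≡ chain-step δ j (δ i xor l) (chain-step δ i l x)
  step-commutes 0F            0F            l x ()
  step-commutes 0F            1F            l x (s≤s ())
  step-commutes 1F            0F            l x (s≤s ())
  step-commutes 0F            (suc (suc e)) l x far = step-commutes-first e l x
  step-commutes (suc (suc e)) 0F            l x far = sym (step-commutes-first e l x)
  step-commutes (suc e)       (suc f)       l tail      far = refl
  step-commutes (suc e)       (suc f)       l (inner x) far = cong inj₂ (link-commutes (δ ∘ suc) e f l x far)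

  finite-Pt : Finite Pt
  finite-Pt = finite-⊎ finite-Unit (finite-⊎ finite-Unit (finite-× finite-Bool (3 + N , ↔-id _)))

  chain-action : Action δ
  chain-action = record
    { Point           = Pt
    ; finite          = finite-Pt
    ; move            = chain-move δ
    ; move-label      = λ _ _ _ → refl
    ; move-involutive = λ { i (l , x) → cong₂ _,_ (xor-cancel (δ i) l) (step-involutive i l x) }
    ; move-commutes   = λ { i j (l , x) far → cong₂ _,_ (xor-swap (δ i) (δ j) l) (step-commutes i j l x far) }
    }

  open ThreeCycle (_≟_ {2 + N})

  a b : Fin (3 + N) → Pt
  a k = inner (pair false k)
  b k = inner (pair true k)

  Acts : List (Fin (4 + N)) → (Bool → Pt → Pt) → Set
  Acts u f = ∀ l x → walk (chain-move δ) u (l , x) ≡ (l , f l x)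

  acts-++ : ∀ u v {f g} → Acts u f → Acts v g → Acts (u ++ v) (λ l → g l ∘ f l)
  acts-++ u v {f} u-acts v-acts l x = trans (walk-++ (chain-move δ) u v (l , x))
    (trans (cong (walk (chain-move δ) v) (u-acts l x)) (v-acts l (f l x)))

  Rotates : List (Fin (4 + N)) → (p q r : Bool → Pt) → Set
  Rotates h p q r = Acts h (λ l → cycle (p l) (q l) (r l))

  step-injective : ∀ i l {x y} → chain-step δ i l x ≡ chain-step δ i l y → x ≡ y
  step-injective i l e =
    trans (sym (step-involutive i l _)) (trans (cong (chain-step δ i (δ i xor l)) e) (step-involutive i l _))

  -- If `i` lies outside I, the conjugate acts at label `l` through the cycle and the step at the
  -- opposite label. For the last colour this makes the result depend on `l`.
  rotates-conjugate : ∀ h {p q r} i {p′ q′ r′} → Rotates h p q r →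
    (∀ l → chain-step δ i (δ i xor l) (p (δ i xor l)) ≡ p′ l) →
    (∀ l → chain-step δ i (δ i xor l) (q (δ i xor l)) ≡ q′ l) →
    (∀ l → chain-step δ i (δ i xor l) (r (δ i xor l)) ≡ r′ l) →
    Rotates (i ∷ h ++ [ i ]) p′ q′ r′
  rotates-conjugate h {p} {q} {r} i {p′} {q′} {r′} rot p-eq q-eq r-eq l x = begin
    walk (chain-move δ) (h ++ [ i ]) (m , x′)                 ≡⟨ walk-++ (chain-move δ) h [ i ] (m , x′) ⟩
    chain-move δ i (walk (chain-move δ) h (m , x′))           ≡⟨ cong (chain-move δ i) (rot m x′) ⟩
    (δ i xor m , π (cycle (p m) (q m) (r m) x′))              ≡⟨ cong₂ _,_ (xor-cancel (δ i) l) conj ⟩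
    (l , cycle (p′ l) (q′ l) (r′ l) x)                        ∎
    where
    open ≡-Reasoning
    m = δ i xor l
    π = chain-step δ i m
    x′ = chain-step δ i l x
    conj : π (cycle (p m) (q m) (r m) x′) ≡ cycle (p′ l) (q′ l) (r′ l) x
    conj rewrite sym (p-eq l) | sym (q-eq l) | sym (r-eq l) =
      trans (sym (cycle-conjugate π (step-injective i m) (p m) (q m) (r m) x′))
            (cong (cycle (π (p m)) (π (q m)) (π (r m))) (step-involutive i l x))

  -- Conjugation pushes the first point of the cycle along the chain one pair at a time, by letters
  -- that fix `tail` and `a 1F`.
  h-rotates-at : ∀ k → ∃ λ h → Rotates h (λ _ → a (suc (suc k))) (λ _ → tail) (λ _ → a 1F)
  h-rotates-at = <-weakInduction _
    (base d₁ , λ l x → base-rotates v x d₁ d₂ l)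
    -- Colour k + 3 is the letter k + 2 of the chain, which exchanges pairs k + 2 and k + 3; the
    -- last colour never occurs.
    λ k (h , rot) → let i = suc (suc (suc (inject₁ k))) in i ∷ h ++ [ i ] , rotates-conjugate h i rot
      (λ l → cong inj₂ (link-joins (δ ∘ suc) (suc (suc k)) _ false)) (λ l → refl) (λ l → refl)

  top : Fin (4 + N)
  top = fromℕ (3 + N)

  A B C : Pt
  A = a (fromℕ (2 + N))
  B = b (fromℕ (2 + N))
  C = inner hub

  -- The image of `A` under `top` taken at the label opposite to the argument, as conjugation
  -- requires.
  ρA : Bool → Pt
  ρA false = C
  ρA true  = B

  -- The commutator of α and β, with squares in place of the inverses of these words of order 3.
  commutator : List (Fin (4 + N)) → List (Fin (4 + N)) → List (Fin (4 + N))
  commutator α β = α ++ β ++ α ++ α ++ β ++ β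

  module Commutator (α β : List (Fin (4 + N))) (f : Bool → Pt → Pt) (g : Pt → Pt)
    (α-acts : Acts α f) (β-acts : Acts β (λ _ → g)) where

    round : Bool → Pt → Pt
    round l x = g (g (f l (f l (g (f l x)))))

    round-acts : Acts (commutator α β) round
    round-acts = acts-++ α (β ++ α ++ α ++ β ++ β) α-acts
                (acts-++ β (α ++ α ++ β ++ β) β-acts
                (acts-++ α (α ++ β ++ β) α-acts
                (acts-++ α (β ++ β) α-acts
                (acts-++ β β β-acts β-acts))))

    commutator-fixes : ∀ l → (∀ x → f l (g x) ≡ g (f l x)) →
                       (∀ x → f l (f l (f l x)) ≡ x) → (∀ x → g (g (g x)) ≡ x) →
                       ∀ x → walk (chain-move δ) (commutator α β) (l , x) ≡ (l , x)
    commutator-fixes l fg≡gf f³ g³ x = trans (round-acts l x) (cong (l ,_) (begin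
      g (g (f l (f l (g (f l x)))))   ≡⟨ cong (λ y → g (g (f l (f l y)))) (fg≡gf x) ⟨
      g (g (f l (f l (f l (g x)))))   ≡⟨ cong (λ y → g (g y)) (f³ (g x)) ⟩
      g (g (g x))                     ≡⟨ g³ x ⟩
      x                               ∎))
      where open ≡-Reasoning

    commutator-moves : ∀ l x₁ x₂ x₃ x₄ x₅ x₆ x₇ →
      f l x₁ ≡ x₂ → g x₂ ≡ x₃ → f l x₃ ≡ x₄ → f l x₄ ≡ x₅ → g x₅ ≡ x₆ → g x₆ ≡ x₇ →
      walk (chain-move δ) (commutator α β) (l , x₁) ≡ (l , x₇)
    commutator-moves l x₁ _ _ _ _ _ _ refl refl refl refl refl refl = round-acts l x₁

  h : List (Fin (4 + N))
  h = proj₁ (h-rotates-at (fromℕ N))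

  h-rotates : Rotates h (λ _ → A) (λ _ → tail) (λ _ → a 1F)
  h-rotates = proj₂ (h-rotates-at (fromℕ N))

  α β : List (Fin (4 + N))
  α = top ∷ h ++ [ top ]
  β = 0F ∷ h ++ [ 0F ]

  α-rotates : Rotates α ρA (λ _ → tail) (λ _ → a 1F)
  α-rotates = rotates-conjugate h top h-rotates moved (λ _ → refl) (λ _ → refl)
    where
    flipped : ∀ l → chain-step δ top (not l) A ≡ ρA l
    flipped false = cong inj₂ (link-last-true (2 + N) (δ ∘ suc))
    flipped true  = cong inj₂ (link-last-false (2 + N) (δ ∘ suc))
    moved : ∀ l → chain-step δ top (δ top xor l) A ≡ ρA l
    moved l = subst (λ d → chain-step δ top (d xor l) A ≡ ρA l) (sym v-last) (flipped l)

  β-rotates : Rotates β (λ _ → B) (λ _ → a 0F) (λ _ → b 1F)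
  β-rotates = rotates-conjugate h 0F h-rotates (λ _ → refl) (λ _ → refl) (λ _ → refl)

  f : Bool → Pt → Pt
  f l = cycle (ρA l) tail (a 1F)

  g : Pt → Pt
  g = cycle B (a 0F) (b 1F)

  open Commutator α β f g α-rotates β-rotates

  -- At label false the cycles are disjoint: `g` fixes `C`, `tail` and `a 1F`, so conjugating by `g`
  -- leaves the cycle `f false` unchanged.
  fg≡gf : ∀ x → f false (g x) ≡ g (f false x)
  fg≡gf = cycle-conjugate g (cycle-injective {B} {a 0F} {b 1F} (λ ()) (λ ()) (λ ())) C tail (a 1F)

  fixes-false : ∀ x → walk (chain-move δ) (commutator α β) (false , x) ≡ (false , x)
  fixes-false = commutator-fixes false fg≡gf (cycle³ {C} {tail} {a 1F} (λ ()) (λ ()) (λ ()))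
                                             (cycle³ {B} {a 0F} {b 1F} (λ ()) (λ ()) (λ ()))

  gB : g B ≡ a 0F
  gB = cycle₁ B (a 0F) (b 1F)

  fB : f true B ≡ tail
  fB = cycle₁ B tail (a 1F)

  -- At label true the cycles share only `B`, so their commutator is again a three-cycle, here
  -- `a 1F` to `B` to `b 1F`. Hence its square is not trivial either.
  first-round : walk (chain-move δ) (commutator α β) (true , a 1F) ≡ (true , B)
  first-round = commutator-moves true (a 1F) B (a 0F) (a 0F) (a 0F) (b 1F) B refl gB refl refl refl refl

  second-round : walk (chain-move δ) (commutator α β) (true , B) ≡ (true , b 1F)
  second-round = commutator-moves true B tail tail (a 1F) B (a 0F) (b 1F) fB refl refl refl gB refl

  square-on-true : let w = commutator α β in walk (chain-move δ) (w ++ w) (true , a 1F) ≡ (true , b 1F)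
  square-on-true = trans (walk-++ (chain-move δ) w w (true , a 1F))
                         (trans (cong (walk (chain-move δ) w) first-round) second-round)
    where w = commutator α β

  square-moves-true : let w = commutator α β in walk (chain-move δ) (w ++ w) (true , a 1F) ≢ (true , a 1F)
  square-moves-true e with () ← trans (sym square-on-true) e

  chain-gadget : Gadget δ
  chain-gadget = record
    { action   = chain-action
    ; w        = commutator α β
    ; w-fixes  = fixes-false
    ; x₀       = a 1F
    ; w²-moves = square-moves-true
    }

-- Gadgets in every rank, by removing end colours in I

gadget : ∀ m (δ : Fin (3 + m) → Bool) i → δ i ≡ true → Gadget δ
gadget zero δ i δᵢ =
  extend-≗ (λ j → sym (Vec.lookup∘tabulate δ j)) (triple-gadget (tabulate δ) i (trans (Vec.lookup∘tabulate δ i) δᵢ))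
gadget (suc m) δ i δᵢ with δ 0F in δ-first | δ (fromℕ (3 + m)) in δ-last
... | false | _     = extend-front δ-first (rest i δᵢ)
  where
  rest : ∀ i → δ i ≡ true → Gadget (δ ∘ suc)
  rest 0F      δᵢ = contradiction (trans (sym δ-first) δᵢ) λ ()
  rest (suc i) δᵢ = gadget m (δ ∘ suc) i δᵢ
-- Colour 0, known to lie outside I, replaces `i` as the witness for the recursive call, since it
-- survives the removal of the last colour.
... | true  | false = extend-back δ-last (gadget m (δ ∘ inject₁) 0F δ-first)
-- Both ends lie outside I: `tip` needs this of the first colour, the rotation of the last.
... | true  | true  = extend-≗ δ≗ (LongChain.chain-gadget (δ 1F) (δ 2F) (tabulate ε)
                                    (trans (Vec.lookup∘tabulate ε (fromℕ m)) δ-last))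
  where
  ε : Fin (suc m) → Bool
  ε k = δ (suc (suc (suc k)))
  δ≗ : δ ≗ lookup (true ∷ δ 1F ∷ δ 2F ∷ tabulate ε)
  δ≗ 0F                  = δ-first
  δ≗ 1F                  = refl
  δ≗ 2F                  = refl
  δ≗ (suc (suc (suc k))) = sym (Vec.lookup∘tabulate ε k)

theorem3 : ∀ (n : ℕ) → 3 ≤ n → ∀ (I : Subset n) → I ⊂ ⊤ → ∃ λ (M : Maniplex n) → IsOfType2 I M
theorem3 (suc (suc (suc m))) (s≤s (s≤s (s≤s _))) I (_ , i , _ , i∉I) =
  gadget⇒maniplex I (i , i∉I) (gadget m (not ∘ lookup I) i (∉⇒swaps I i∉I))
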